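{- (i) If $n=1$ or $n=2$, then the lattice $P_n$ of partitions of an $n$-element set is isomorphic to the lattice induced by a covering, i.e. there are a finite set $U$ and a covering $\mathcal{C}$ of $U$ with $L(\mathcal{C})\cong P_n$. (ii) Let $\mathcal{C}$ be a covering of a finite set $U$ with $|U|=m$, such that there are no two distinct elements $u,v\in U$ with $\mathcal{C}(\{u\})=\mathcal{C}(\{v\})$ and $|\mathcal{C}(\{u\})|=1$. Suppose that $L(\mathcal{C})$ is uniform and $|L^{(2)}(\mathcal{C})|<\binom{m}{2}$, and let $k:=|\mathcal{E}|$. If $m=3$ and $k=1$, then $L(\mathcal{C})\cong P_3$.
   Context: A covering of a finite set $U$ (possibly empty) is a collection $\mathcal{C}\subseteq 2^U$ of subsets of $U$ whose union is $U$. For $H\subseteq U$, $\mathcal{C}(H):=\{C\in\mathcal{C} : C\cap H\neq\emptyset\}$. The matroid $M(\mathcal{C})$ is the transversal matroid of $\mathcal{C}$ on the ground set $U$: its independent sets are the partial transversals of $\mathcal{C}$, i.e. the sets $I\subseteq U$ for which there is an injective map $\varphi:I\to\mathcal{C}$ with $e\in\varphi(e)$ for all $e\in I$. $L(\mathcal{C})$ is the lattice of closed sets (flats) of $M(\mathcal{C})$ ordered by inclusion, and $L^{(\ell)}(\mathcal{C})$ is the set of its elements of height $\ell$. A ranked lattice is uniform if any two elements of equal rank are covered by the same number of elements. $P_n$ is ordered by refinement: $\pi\leq\sigma$ if every block of $\pi$ is contained in a block of $\sigma$. For $x\in U$ with $|\mathcal{C}(\{x\})|=2$, $E(\{x\}):=\{y\in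 U : \mathcal{C}(\{y\})\subseteq\mathcal{C}(\{x\})\}$, and $\mathcal{E}:=\{E(\{x\}) : x\in U,\ |\mathcal{C}(\{x\})|=2\}$. -}

module Defs where

open import Data.Bool.Properties as Bool using ()
open import Data.Fin using (Fin)
open import Data.Fin.Subset
  using (Subset; _∈_; _⊆_; _∩_; _∪_; ⁅_⁆; ∣_∣; Nonempty)
open import Data.Fin.Subset.Properties using (nonempty?; ⊆-poset; ⊆-antisym)
open import Data.List using (List; length; filter; map; deduplicate; allFin)
open import Data.List.Membership.Propositional as List using ()
import Data.List.Membership.Setoid as SetoidMembership
open import Data.List.Relation.Binary.BagAndSetEquality using (set; _∼[_]_; [_]-Equality)
import Data.List.Relation.Binary.Subset.DecPropositional as ListSubset
open import Data.List.Relation.Unary.Unique.Propositional using (Unique)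
import Data.List.Relation.Unary.Unique.Setoid as SetoidUnique
open import Data.Nat using (ℕ; zero; suc; _≤_; _≟_)
open import Data.Product using (Σ-syntax; ∃; ∃-syntax; _×_; _,_)
open import Data.Vec using (tabulate)
import Data.Vec.Properties as Vec
open import Function using (_⇔_; mk⇔; Equivalence; id)
open import Function.Related.Propositional using (equivalence)
open import Level using (0ℓ)
open import Relation.Binary using (Poset; Setoid; DecidableEquality)
import Relation.Binary.Construct.On as On
open import Relation.Binary.Morphism.Structures using (IsOrderIsomorphism)
open import Relation.Binary.PropositionalEquality using (_≡_; refl; sym; subst)
open import Relation.Nullary using (¬_; does)
open import Relation.Unary using (Pred)

private
  variable
    m : ℕ

infix 4 _≅_ _≟ˢ_

module _ (P : Poset 0ℓ 0ℓ 0ℓ) where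
  open Poset P renaming (_≤_ to _≼_)
  open SetoidMembership Eq.setoid using () renaming (_∈_ to _∈ˡ_)
  open SetoidUnique Eq.setoid using () renaming (Unique to Uniqueˡ)

  -- The predicate Q, regarded as a subset of P, has exactly n elements.
  HasCard : Pred Carrier 0ℓ → ℕ → Set
  HasCard Q n = Σ[ xs ∈ List Carrier ]
    Uniqueˡ xs × (∀ x → Q x ⇔ x ∈ˡ xs) × length xs ≡ n

  infix 4 _≺_ _CoveredBy_

  _≺_ : Carrier → Carrier → Set
  x ≺ y = x ≼ y × ¬ (x ≈ y)

  _CoveredBy_ : Carrier → Carrier → Set
  x CoveredBy y = x ≺ y × (∀ z → ¬ (x ≺ z × z ≺ y))

  -- Chains x₀ ≺ x₁ ≺ … ≺ x_ℓ, indexed by their top x_ℓ and length ℓ.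
  data Chain : Carrier → ℕ → Set where
    start : ∀ {x} → Chain x zero
    step  : ∀ {x y ℓ} → Chain x ℓ → x ≺ y → Chain y (suc ℓ)

  HasHeight : ℕ → Pred Carrier 0ℓ
  HasHeight h x = Chain x h × (∀ ℓ → Chain x ℓ → ℓ ≤ h)

  -- In a ranked lattice the rank of an element is its height.
  Uniform : Set
  Uniform = ∀ x y h → HasHeight h x → HasHeight h y →
    ∃[ n ] HasCard (x CoveredBy_) n × HasCard (y CoveredBy_) n

-- An order isomorphism between lattices is the same as a lattice isomorphism.
_≅_ : Poset 0ℓ 0ℓ 0ℓ → Poset 0ℓ 0ℓ 0ℓ → Set
P ≅ Q = ∃ (IsOrderIsomorphism P._≈_ Q._≈_ P._≤_ Q._≤_)
  where
  module P = Poset P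
  module Q = Poset Q

module _ (Independent : Pred (Subset m) 0ℓ) where

  HasRank : Subset m → ℕ → Set
  HasRank X r =
    (∃[ I ] I ⊆ X × Independent I × ∣ I ∣ ≡ r) ×
    (∀ I → I ⊆ X → Independent I → ∣ I ∣ ≤ r)

  infix 4 _∈cl_

  -- x lies in the closure of X when adding x to X does not change the rank.
  _∈cl_ : Fin m → Subset m → Set
  x ∈cl X = ∃[ r ] HasRank X r × HasRank (X ∪ ⁅ x ⁆) r

  record Flat : Set where
    field
      elements : Subset m
      closed   : ∀ x → x ∈cl elements → x ∈ elements

  flats : Poset 0ℓ 0ℓ 0ℓ
  flats = On.poset (⊆-poset m) Flat.elements

-- The finite set is Fin m.  The collection is a duplicate-free list; nothing
-- below depends on its order.
record Covering (m : ℕ) : Set where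
  field
    members : List (Subset m)
    unique  : Unique members
    covers  : ∀ x → ∃[ C ] C List.∈ members × x ∈ C

open Covering public using (members)

_≟ˢ_ : DecidableEquality (Subset m)
_≟ˢ_ = Vec.≡-dec Bool._≟_

module _ (𝒞 : Covering m) where

  meeting : Subset m → List (Subset m)
  meeting H = filter (λ C → nonempty? (C ∩ H)) (members 𝒞)

  -- φ is only constrained on I, so it stands for a map I → 𝒞.
  PartialTransversal : Pred (Subset m) 0ℓ
  PartialTransversal I = Σ[ φ ∈ (Fin m → Subset m) ]
    (∀ e → e ∈ I → φ e List.∈ members 𝒞 × e ∈ φ e) ×
    (∀ e f → e ∈ I → f ∈ I → φ e ≡ φ f → e ≡ f)

  L : Poset 0ℓ 0ℓ 0ℓ
  L = flats PartialTransversal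

  E : Fin m → Subset m
  E x = tabulate (λ y → does (meeting ⁅ y ⁆ ⊆? meeting ⁅ x ⁆))
    where open ListSubset _≟ˢ_ using (_⊆?_)

  ℰ : List (Subset m)
  ℰ = deduplicate _≟ˢ_
    (map E (filter (λ x → length (meeting ⁅ x ⁆) ≟ 2) (allFin m)))

record Partition (n : ℕ) : Set where
  field
    blocks   : List (Subset n)
    nonempty : ∀ {B} → B List.∈ blocks → Nonempty B
    disjoint : ∀ {B B′ x} → B List.∈ blocks → B′ List.∈ blocks →
               x ∈ B → x ∈ B′ → B ≡ B′
    covers   : ∀ x → ∃[ B ] B List.∈ blocks × x ∈ B

module _ {n : ℕ} where
  open Partition

  infix 4 _⊑_

  _⊑_ : Partition n → Partition n → Set
  π ⊑ σ = ∀ {B} → B List.∈ blocks π → ∃[ B′ ] B′ List.∈ blocks σ × B ⊆ B′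

  ⊑-antisym-⊆ : ∀ π σ → π ⊑ σ → σ ⊑ π →
                ∀ {B} → B List.∈ blocks π → B List.∈ blocks σ
  ⊑-antisym-⊆ π σ π⊑σ σ⊑π {B} B∈π with π⊑σ B∈π
  ... | B′ , B′∈σ , B⊆B′ with σ⊑π B′∈σ
  ... | B″ , B″∈π , B′⊆B″ = subst (List._∈ blocks σ) (sym B≡B′) B′∈σ
    where
    B≡B″ : B ≡ B″
    B≡B″ with nonempty π B∈π
    ... | x , x∈B = disjoint π B∈π B″∈π x∈B (B′⊆B″ (B⊆B′ x∈B))

    B≡B′ : B ≡ B′
    B≡B′ = ⊆-antisym B⊆B′ (λ {x} x∈B′ → subst (x ∈_) (sym B≡B″) (B′⊆B″ x∈B′))

-- Partitions of Fin n under refinement; two are equal when they have the same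
-- blocks, whatever the order and multiplicity in which these are listed.
P : ℕ → Poset 0ℓ 0ℓ 0ℓ
P n = record
  { Carrier = Partition n
  ; _≈_     = λ π σ → blocks π ∼[ set ] blocks σ
  ; _≤_     = _⊑_
  ; isPartialOrder = record
    { isPreorder = record
      { isEquivalence = On.isEquivalence blocks
          (Setoid.isEquivalence ([ equivalence ]-Equality (Subset n)))
      ; reflexive = λ π≈σ {B} B∈π → B , Equivalence.to π≈σ B∈π , id
      ; trans     = λ π⊑σ σ⊑τ B∈π →
          let _ , B′∈σ , B⊆B′   = π⊑σ B∈π
              B″ , B″∈τ , B′⊆B″ = σ⊑τ B′∈σ
          in B″ , B″∈τ , λ x∈B → B′⊆B″ (B⊆B′ x∈B)
      }
    ; antisym = λ {π} {σ} π⊑σ σ⊑π →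
        mk⇔ (⊑-antisym-⊆ π σ π⊑σ σ⊑π) (⊑-antisym-⊆ σ π σ⊑π π⊑σ)
    }
  }
  where
  open Partition using (blocks)

-- In each case M(𝒞) is the cycle matroid of the complete graph K_n on the
-- vertices Fin n.  An edge set X is a flat exactly when adjacency in the graph
-- (Fin n, X) is transitive, and the partition assigned to such an X has the
-- closed neighbourhoods of the graph as its blocks.  For n ≤ 2 the matroid is
-- free.  In part (ii) it is U₂,₃: a matching of a pair of points can fail only
-- if both points lie in one and the same member of 𝒞 and in no other, which is
-- excluded; and if all three points were independent, every subset would be
-- closed, giving three flats of height 2.
module Submission where

open import Defs
open import Data.Bool using (Bool; true; false)
open import Data.Fin using (Fin)
import Data.Fin.Properties as Fin
open import Data.Fin.Subset
  using (Subset; _∈_; _∉_; _⊆_; _∩_; _∪_; ⁅_⁆; ∣_∣; ⊤; ⊥; ∁)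
open import Data.Fin.Subset.Properties
  using (_∈?_; _⊆?_; nonempty?; ⊆-antisym; ⊆-reflexive; ⊆⊤; ∣p∣≤n;
         x∈⁅x⁆; x∈⁅y⁆⇒x≡y; x∈p∪q⁻; x∈p∩q⁺; x∈p∩q⁻; p⊆p∪q; q⊆p∪q;
         p⊆q⇒∣p∣≤∣q∣; p⊂q⇒∣p∣<∣q∣; ∣p∣≡n⇒p≡⊤; anySubset?)
open import Data.List using ([]; _∷_; length)
import Data.List as List
open import Data.List.Membership.Propositional as List using (find; lose)
open import Data.List.Membership.Propositional.Properties
  using (∈-filter⁺; ∈-filter⁻; ∈-map⁺; ∈-allFin; ∈-tabulate⁺; ∈-tabulate⁻)
open import Data.List.Membership.Setoid.Properties using (index-injective)
open import Data.List.Relation.Binary.BagAndSetEquality using (_∼[_]_; set)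
open import Data.List.Relation.Unary.All using (_∷_)
open import Data.List.Relation.Unary.Any using (here; there; any?)
open import Data.List.Relation.Unary.AllPairs using (_∷_)
open import Data.List.Relation.Unary.Unique.Propositional using (Unique)
import Data.List.Relation.Unary.Unique.Propositional.Properties as Unique
open import Data.Nat using (ℕ; zero; suc; _≤_; _<_; z≤n; s≤s; _≤?_)
import Data.Nat.Properties as ℕ
open import Data.Nat.Combinatorics using (_C_)
open import Data.Product using (_×_; _,_; proj₁; proj₂; ∃-syntax; Σ-syntax)
open import Data.Sum using (_⊎_; inj₁; inj₂)
open import Data.Vec using (Vec; []; _∷_; lookup; tabulate)
import Data.Vec.Properties as Vec
open import Function using (_⇔_; mk⇔; Equivalence; id; _∘_)
open import Level using (0ℓ)
open import Relation.Binary using (Poset)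
open import Relation.Binary.PropositionalEquality
  using (_≡_; _≢_; refl; sym; trans; cong; subst; subst₂)
open import Relation.Nullary using (¬_; Dec; yes; no; contradiction)
open import Relation.Nullary.Decidable
  using (¬?; _×-dec_; _⊎-dec_; _→-dec_; map′; from-yes; decidable-stable)
open import Relation.Unary using (Decidable)

private
  variable
    m n : ℕ

-- Deciding universal statements over finite types

-- The decider for entries is a parameter because two instances occur: Boolean entries give subsets,
-- and subsets as entries give candidate block maps.
allVec? : ∀ {A : Set} →
          (∀ {Q : A → Set} → Decidable Q → Dec (∀ x → Q x)) →
          ∀ {k} {Q : Vec A k → Set} → Decidable Q → Dec (∀ v → Q v)
allVec? all? {zero}  Q? = map′ (λ { q [] → q }) (λ q → q []) (Q? [])
allVec? all? {suc k} Q? =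
  map′ (λ { q (x ∷ v) → q x v }) (λ q x v → q (x ∷ v))
    (all? λ x → allVec? all? λ v → Q? (x ∷ v))

allBool? : ∀ {Q : Bool → Set} → Decidable Q → Dec (∀ b → Q b)
allBool? Q? = map′ (λ { (f , t) false → f ; (f , t) true → t })
                   (λ q → q false , q true) (Q? false ×-dec Q? true)

allSubset? : ∀ {Q : Subset n → Set} → Decidable Q → Dec (∀ X → Q X)
allSubset? = allVec? allBool?

-- Partitions as block maps

-- Row i of a block map is the block containing i.
IsBlockMap : Vec (Subset n) n → Set
IsBlockMap R = ∀ i → i ∈ lookup R i ×
                     (∀ j → i ∈ lookup R j → lookup R j ≡ lookup R i)

isBlockMap? : Decidable (IsBlockMap {n})
isBlockMap? R = Fin.all? λ i → i ∈? lookup R i ×-dec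
  Fin.all? λ j → (i ∈? lookup R j) →-dec (lookup R j ≟ˢ lookup R i)

infix 4 _≤ᵇ_

_≤ᵇ_ : Vec (Subset n) n → Vec (Subset n) n → Set
R ≤ᵇ S = ∀ i → lookup R i ⊆ lookup S i

_≤ᵇ?_ : (R S : Vec (Subset n) n) → Dec (R ≤ᵇ S)
R ≤ᵇ? S = Fin.all? λ i → lookup R i ⊆? lookup S i

toPartition : (R : Vec (Subset n) n) → IsBlockMap R → Partition n
toPartition R isB = record
  { blocks   = List.tabulate (lookup R)
  ; nonempty = λ B∈ → let i , B≡ = ∈-tabulate⁻ B∈ in
      i , subst (i ∈_) (sym B≡) (proj₁ (isB i))
  ; disjoint = λ { {x = x} B∈ B′∈ x∈B x∈B′ → trans (row B∈ x∈B) (sym (row B′∈ x∈B′)) }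
  ; covers   = λ x → lookup R x , ∈-tabulate⁺ x , proj₁ (isB x)
  }
  where
  row : ∀ {B x} → B List.∈ List.tabulate (lookup R) → x ∈ B → B ≡ lookup R x
  row {x = x} B∈ x∈B with ∈-tabulate⁻ B∈
  ... | j , refl = proj₂ (isB x) j x∈B

≤ᵇ⇒⊑ : ∀ (R S : Vec (Subset n) n) {r s} → R ≤ᵇ S → toPartition R r ⊑ toPartition S s
≤ᵇ⇒⊑ R S R≤S B∈ with ∈-tabulate⁻ B∈
... | i , refl = lookup S i , ∈-tabulate⁺ i , R≤S i

⊑⇒≤ᵇ : ∀ (R S : Vec (Subset n) n) {r s} → toPartition R r ⊑ toPartition S s → R ≤ᵇ S
⊑⇒≤ᵇ R S {r} {s} R⊑S i with R⊑S (∈-tabulate⁺ i)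
... | B , B∈ , Rᵢ⊆B with ∈-tabulate⁻ B∈
-- The block `B` is row `j` of `S`. It contains `i`, since row `i` of `R` does, so it coincides with
-- row `i` of `S`.
... | j , refl = subst (_ ⊆_) (proj₂ (s i) j (Rᵢ⊆B (proj₁ (r i)))) Rᵢ⊆B

module _ (π : Partition n) where
  open Partition π

  blockMap : Vec (Subset n) n
  blockMap = tabulate (λ x → proj₁ (covers x))

  lookup-blockMap : ∀ x → lookup blockMap x ≡ proj₁ (covers x)
  lookup-blockMap = Vec.lookup∘tabulate _

  row∈blocks : ∀ x → lookup blockMap x List.∈ blocks
  row∈blocks x = subst (List._∈ blocks) (sym (lookup-blockMap x)) (proj₁ (proj₂ (covers x)))

  x∈row : ∀ x → x ∈ lookup blockMap x
  x∈row x = subst (x ∈_) (sym (lookup-blockMap x)) (proj₂ (proj₂ (covers x)))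

  blockMap-isBlockMap : IsBlockMap blockMap
  blockMap-isBlockMap i =
    x∈row i , λ j i∈ → disjoint (row∈blocks j) (row∈blocks i) i∈ (x∈row i)

  toPartition-blockMap : ∀ r → Poset._≈_ (P n) (toPartition blockMap r) π
  toPartition-blockMap r {B} = mk⇔ to from
    where
    to : B List.∈ List.tabulate (lookup blockMap) → B List.∈ blocks
    to B∈ with ∈-tabulate⁻ B∈
    ... | i , refl = row∈blocks i

    from : B List.∈ blocks → B List.∈ List.tabulate (lookup blockMap)
    -- A point of the block is needed to name a row; by disjointness the row at that point is the
    -- block.
    from B∈ with nonempty B∈
    ... | x , x∈B = subst (List._∈ _) (disjoint (row∈blocks x) B∈ (x∈row x) x∈B)
                          (∈-tabulate⁺ x)

-- Flats, closed sets and chains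

module _ (Independent : Subset m → Set) where

  Closed : Subset m → Set
  Closed X = ∀ x → _∈cl_ Independent x X → x ∈ X

  -- X is read as an edge set; row i of nbhd X is the closed neighbourhood of i.
  flats≅P : (nbhd : Subset m → Vec (Subset n) n) →
            (∀ X Y → X ⊆ Y → nbhd X ≤ᵇ nbhd Y) →
            (∀ X Y → nbhd X ≤ᵇ nbhd Y → X ⊆ Y) →
            (∀ R → IsBlockMap R → ∃[ X ] nbhd X ≡ R) →
            (∀ X → Closed X ⇔ IsBlockMap (nbhd X)) →
            flats Independent ≅ P n
  flats≅P {n} nbhd mono cancel onto closed⇔ = part , record
    { isOrderMonomorphism = record
      { isOrderHomomorphism = record
        { cong = λ {F} {G} → part-cong F G
        ; mono = λ {F} {G} → part-mono F G
        }
      ; injective = λ {F} {G} eq → ⊆-antisym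
          (part-cancel F G (P.reflexive {part F} {part G} eq))
          (part-cancel G F (P.reflexive {part G} {part F} (P.Eq.sym {part F} {part G} eq)))
      ; cancel = λ {F} {G} → part-cancel F G
      }
    ; surjective = surjective
    }
    where
    module P = Poset (P n)
    open Flat

    isB : (F : Flat Independent) → IsBlockMap (nbhd (elements F))
    isB F = Equivalence.to (closed⇔ (elements F)) (closed F)

    part : Flat Independent → Partition n
    part F = toPartition (nbhd (elements F)) (isB F)

    part-mono : ∀ F G → elements F ⊆ elements G → part F ⊑ part G
    part-mono F G F⊆G = ≤ᵇ⇒⊑ (nbhd (elements F)) (nbhd (elements G)) {isB F} {isB G}
      (mono (elements F) (elements G) F⊆G)

    part-cong : ∀ F G → elements F ≡ elements G → part F P.≈ part G
    part-cong F G eq = P.antisym {part F} {part G}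
      (part-mono F G (⊆-reflexive eq)) (part-mono G F (⊆-reflexive (sym eq)))

    part-cancel : ∀ F G → part F ⊑ part G → elements F ⊆ elements G
    part-cancel F G F⊑G = cancel (elements F) (elements G)
      (⊑⇒≤ᵇ (nbhd (elements F)) (nbhd (elements G)) {isB F} {isB G} F⊑G)

    surjective : ∀ π → ∃[ F ] (∀ {G} → elements G ≡ elements F → part G P.≈ π)
    surjective π with onto (blockMap π) (blockMap-isBlockMap π)
    ... | X , eq = F , λ {G} G≡F →
      P.Eq.trans {part G} {part F} {π} (part-cong G F G≡F) partF≈π
      where
      F : Flat Independent
      F = record
        { elements = X
        ; closed   = Equivalence.from (closed⇔ X)
                       (subst IsBlockMap (sym eq) (blockMap-isBlockMap π))
        }

      partF≈π : part F P.≈ π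
      partF≈π = lemma eq (isB F)
        where
        -- Neither side of `eq` is a variable, so `nbhd X` is generalised to `R`, together with the
        -- proof about it, before matching on `refl`.
        lemma : ∀ {R} → R ≡ blockMap π → (r : IsBlockMap R) → toPartition R r P.≈ π
        lemma refl = toPartition-blockMap π

  -- An independent `X ∪ ⁅ x ⁆` has its cardinality as rank, which exceeds the size of `X` and hence
  -- the rank of `X`. No outside point can therefore lie in the closure.
  closed-if-extensions-independent :
    ∀ X → (∀ x → x ∉ X → Independent (X ∪ ⁅ x ⁆)) → Closed X
  closed-if-extensions-independent X indep x
    (r , ((I , I⊆X , _ , ∣I∣≡r) , _) , (_ , max)) with x ∈? X
  ... | yes x∈X = x∈X
  ... | no  x∉X = contradiction ∣X∪x∣≤∣X∣ (ℕ.<⇒≱ ∣X∣<∣X∪x∣)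
    where
    ∣X∪x∣≤∣X∣ : ∣ X ∪ ⁅ x ⁆ ∣ ≤ ∣ X ∣
    ∣X∪x∣≤∣X∣ = ℕ.≤-trans (max _ id (indep x x∉X))
      (subst (_≤ ∣ X ∣) ∣I∣≡r (p⊆q⇒∣p∣≤∣q∣ I⊆X))

    ∣X∣<∣X∪x∣ : ∣ X ∣ < ∣ X ∪ ⁅ x ⁆ ∣
    ∣X∣<∣X∪x∣ = p⊂q⇒∣p∣<∣q∣ (p⊆p∪q _ , x , q⊆p∪q X _ (x∈⁅x⁆ x) , x∉X)

  ≺⇒∣∣< : ∀ (F G : Flat Independent) → _≺_ (flats Independent) F G →
          ∣ Flat.elements F ∣ < ∣ Flat.elements G ∣
  ≺⇒∣∣< F G (F⊆G , F≢G) with ℕ.m≤n⇒m<n∨m≡n (p⊆q⇒∣p∣≤∣q∣ F⊆G)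
  ... | inj₁ lt = lt
  ... | inj₂ eq = contradiction (⊆-antisym F⊆G G⊆F) F≢G
    where
    G⊆F : Flat.elements G ⊆ Flat.elements F
    G⊆F {x} x∈G with x ∈? Flat.elements F
    ... | yes x∈F = x∈F
    ... | no  x∉F = contradiction eq (ℕ.<⇒≢ (p⊂q⇒∣p∣<∣q∣ (F⊆G , x , x∈G , x∉F)))

  -- Supplies the upper bound in `HasHeight`: the number of elements grows with every step of a
  -- chain.
  chain-length : ∀ F {ℓ} → Chain (flats Independent) F ℓ → ℓ ≤ ∣ Flat.elements F ∣
  chain-length F start = z≤n
  chain-length F (step {x = G} c G≺F) =
    ℕ.≤-trans (s≤s (chain-length G c)) (≺⇒∣∣< G F G≺F)

-- Lower bounds for cardinalities

module _ (Q : Poset 0ℓ 0ℓ 0ℓ) where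
  open Poset Q using (Carrier; _≈_; module Eq)

  -- Sending `i` to the position of `f i` in the enumerating list is injective, as entries at equal
  -- positions agree.
  HasCard⇒≤ : ∀ {R : Carrier → Set} {k w} → HasCard Q R w → (f : Fin k → Carrier) →
              (∀ i → R (f i)) → (∀ {i j} → f i ≈ f j → i ≡ j) → k ≤ w
  HasCard⇒≤ (xs , _ , R⇔∈ , refl) f Rf f-inj =
    Fin.injective⇒≤ (λ {i} {j} eq → f-inj (index-injective Eq.setoid
      (Equivalence.to (R⇔∈ (f i)) (Rf i)) (Equivalence.to (R⇔∈ (f j)) (Rf j)) eq))

-- The free matroid

singletons : ∀ m → Covering m
singletons m = record
  { members = List.map ⁅_⁆ (List.allFin m)
  ; unique  = Unique.map⁺ (λ {x} {y} eq → x∈⁅y⁆⇒x≡y y (subst (x ∈_) eq (x∈⁅x⁆ x)))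
                          (Unique.allFin⁺ m)
  ; covers  = λ x → ⁅ x ⁆ , ∈-map⁺ ⁅_⁆ (∈-allFin x) , x∈⁅x⁆ x
  }

singletons-independent : ∀ X → PartialTransversal (singletons m) X
singletons-independent X =
  ⁅_⁆ , (λ e _ → ∈-map⁺ ⁅_⁆ (∈-allFin e) , x∈⁅x⁆ e) ,
  λ e f _ _ eq → x∈⁅y⁆⇒x≡y f (subst (e ∈_) eq (x∈⁅x⁆ e))

-- Independence of pairs

unique-singleton : ∀ {A : Set} {x : A} {xs} → Unique xs → x List.∈ xs →
                   (∀ {y} → y List.∈ xs → y ≡ x) → xs ≡ x ∷ []
unique-singleton {xs = _ ∷ []}    _               x∈ all≡ = cong (_∷ []) (all≡ (here refl))
unique-singleton {xs = _ ∷ _ ∷ _} ((y≢z ∷ _) ∷ _) x∈ all≡ =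
  contradiction (trans (all≡ (here refl)) (sym (all≡ (there (here refl))))) y≢z

module _ (𝒞 : Covering m) where

  independent-⊆ : ∀ {I J} → I ⊆ J → PartialTransversal 𝒞 J → PartialTransversal 𝒞 I
  independent-⊆ I⊆J (φ , φ∈ , φ-inj) =
    φ , (λ e e∈ → φ∈ e (I⊆J e∈)) , λ e f e∈ f∈ → φ-inj e f (I⊆J e∈) (I⊆J f∈)

  ∈-meeting⁺ : ∀ {A u} → A List.∈ members 𝒞 → u ∈ A → A List.∈ meeting 𝒞 ⁅ u ⁆
  ∈-meeting⁺ {u = u} A∈ u∈A =
    ∈-filter⁺ (λ A → nonempty? (A ∩ ⁅ u ⁆)) A∈ (u , x∈p∩q⁺ (u∈A , x∈⁅x⁆ u))

  ∈-meeting⁻ : ∀ {A u} → A List.∈ meeting 𝒞 ⁅ u ⁆ → A List.∈ members 𝒞 × u ∈ A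
  ∈-meeting⁻ {A} {u} A∈ with ∈-filter⁻ (λ A → nonempty? (A ∩ ⁅ u ⁆)) {xs = members 𝒞} A∈
  ... | A∈𝒞 , x , x∈ with x∈p∩q⁻ A ⁅ u ⁆ x∈
  ... | x∈A , x∈u = A∈𝒞 , subst (_∈ A) (x∈⁅y⁆⇒x≡y u x∈u) x∈A

  -- An equality of lists, rather than of sets, lets one substitution produce both the equality of
  -- two meeting lists and their length 1.
  meeting≡[_] : ∀ {u} A → A List.∈ members 𝒞 → u ∈ A →
                (∀ {B} → B List.∈ members 𝒞 → u ∈ B → B ≡ A) → meeting 𝒞 ⁅ u ⁆ ≡ A ∷ []
  meeting≡[_] {u} A A∈ u∈A only = unique-singleton
    (Unique.filter⁺ (λ A → nonempty? (A ∩ ⁅ u ⁆)) (Covering.unique 𝒞))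
    (∈-meeting⁺ A∈ u∈A)
    (λ B∈ → let B∈𝒞 , u∈B = ∈-meeting⁻ B∈ in only B∈𝒞 u∈B)

  two-members-independent : ∀ {u v A B} → A List.∈ members 𝒞 → B List.∈ members 𝒞 →
    A ≢ B → u ∈ A → v ∈ B → PartialTransversal 𝒞 (⁅ u ⁆ ∪ ⁅ v ⁆)
  two-members-independent {u} {v} {A} {B} A∈ B∈ A≢B u∈A v∈B = φ , φ∈ , φ-inj
    where
    φ : Fin m → Subset m
    φ e with e Fin.≟ u
    ... | yes _ = A
    -- `B` is the value at `v` and also the default off the pair, where `φ` is unconstrained.
    ... | no  _ = B

    is-v : ∀ {e} → e ≢ u → e ∈ ⁅ u ⁆ ∪ ⁅ v ⁆ → e ≡ v
    is-v e≢u e∈ with x∈p∪q⁻ ⁅ u ⁆ ⁅ v ⁆ e∈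
    ... | inj₁ e∈u = contradiction (x∈⁅y⁆⇒x≡y u e∈u) e≢u
    ... | inj₂ e∈v = x∈⁅y⁆⇒x≡y v e∈v

    φ∈ : ∀ e → e ∈ ⁅ u ⁆ ∪ ⁅ v ⁆ → φ e List.∈ members 𝒞 × e ∈ φ e
    φ∈ e e∈ with e Fin.≟ u
    ... | yes refl = A∈ , u∈A
    ... | no  e≢u  = B∈ , subst (_∈ B) (sym (is-v e≢u e∈)) v∈B

    φ-inj : ∀ e f → e ∈ ⁅ u ⁆ ∪ ⁅ v ⁆ → f ∈ ⁅ u ⁆ ∪ ⁅ v ⁆ → φ e ≡ φ f → e ≡ f
    φ-inj e f e∈ f∈ eq with e Fin.≟ u | f Fin.≟ u
    ... | yes e≡u | yes f≡u = trans e≡u (sym f≡u)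
    ... | yes _   | no  _   = contradiction eq A≢B
    ... | no  _   | yes _   = contradiction (sym eq) A≢B
    ... | no  e≢u | no  f≢u = trans (is-v e≢u e∈) (sym (is-v f≢u f∈))

  -- Covering members are chosen for `u` and `v`. If they coincide in `A`, any other member
  -- containing `u` or `v` can replace one of them; if there is none, both meeting lists are
  -- `A ∷ []`, which the hypothesis forbids.
  pair-independent : ∀ {u v} →
    ¬ (meeting 𝒞 ⁅ u ⁆ ∼[ set ] meeting 𝒞 ⁅ v ⁆ × length (meeting 𝒞 ⁅ u ⁆) ≡ 1) →
    PartialTransversal 𝒞 (⁅ u ⁆ ∪ ⁅ v ⁆)
  pair-independent {u} {v} distinct with Covering.covers 𝒞 u | Covering.covers 𝒞 v
  ... | A , A∈ , u∈A | B , B∈ , v∈B with A ≟ˢ B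
  ... | no  A≢B  = two-members-independent A∈ B∈ A≢B u∈A v∈B
  ... | yes refl with any? (λ B → ¬? (B ≟ˢ A) ×-dec (u ∈? B ⊎-dec v ∈? B)) (members 𝒞)
  ... | yes other with find other
  ...   | B′ , B′∈ , B′≢A , inj₁ u∈B′ = two-members-independent B′∈ B∈ B′≢A u∈B′ v∈B
  ...   | B′ , B′∈ , B′≢A , inj₂ v∈B′ =
    two-members-independent A∈ B′∈ (B′≢A ∘ sym) u∈A v∈B′
  pair-independent {u} {v} distinct | A , A∈ , u∈A | _ , _ , v∈A | yes refl | no none =
    contradiction
      (subst₂ (λ xs ys → xs ∼[ set ] ys × length xs ≡ 1)
        (sym (meeting≡[ A ] A∈ u∈A λ B∈ u∈B → only B∈ (inj₁ u∈B)))
        (sym (meeting≡[ A ] A∈ v∈A λ B∈ v∈B → only B∈ (inj₂ v∈B)))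
        (mk⇔ id id , refl))
      distinct
    where
    only : ∀ {B} → B List.∈ members 𝒞 → u ∈ B ⊎ v ∈ B → B ≡ A
    only {B} B∈ uv∈B = decidable-stable (B ≟ˢ A) λ B≢A → none (lose B∈ (B≢A , uv∈B))

-- Complete graphs on at most three vertices

-- This map and the next two give the adjacency matrix of the graph, with `true` on the diagonal so
-- that every vertex lies in its own row.
nbhd₁ : Subset 0 → Vec (Subset 1) 1
nbhd₁ [] = (true ∷ []) ∷ []

nbhd₂ : Subset 1 → Vec (Subset 2) 2
nbhd₂ (e ∷ []) = (true ∷ e ∷ []) ∷ (e ∷ true ∷ []) ∷ []

-- Edge i of the triangle is the one opposite to vertex i.
nbhd₃ : Subset 3 → Vec (Subset 3) 3
nbhd₃ (e₀ ∷ e₁ ∷ e₂ ∷ []) =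
  (true ∷ e₂ ∷ e₁ ∷ []) ∷ (e₂ ∷ true ∷ e₀ ∷ []) ∷ (e₁ ∷ e₀ ∷ true ∷ []) ∷ []

module _ (nbhd : Subset m → Vec (Subset n) n) where

  mono? : Dec (∀ X Y → X ⊆ Y → nbhd X ≤ᵇ nbhd Y)
  mono? = allSubset? λ X → allSubset? λ Y → (X ⊆? Y) →-dec (nbhd X ≤ᵇ? nbhd Y)

  cancel? : Dec (∀ X Y → nbhd X ≤ᵇ nbhd Y → X ⊆ Y)
  cancel? = allSubset? λ X → allSubset? λ Y → (nbhd X ≤ᵇ? nbhd Y) →-dec (X ⊆? Y)

  onto? : Dec (∀ R → IsBlockMap R → ∃[ X ] nbhd X ≡ R)
  onto? = allVec? allSubset? λ R →
    isBlockMap? R →-dec anySubset? λ X → Vec.≡-dec _≟ˢ_ (nbhd X) R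

-- One and two vertices

-- Both sides hold for every `X`: all sets are closed in a free matroid, and with at most one edge
-- adjacency is always transitive, which is how `isB` is met below.
singletons-closed⇔ : (nbhd : Subset m → Vec (Subset n) n) → (∀ X → IsBlockMap (nbhd X)) →
                     ∀ X → Closed (PartialTransversal (singletons m)) X ⇔ IsBlockMap (nbhd X)
singletons-closed⇔ nbhd isB X = mk⇔ (λ _ → isB X) λ _ →
  closed-if-extensions-independent _ X λ _ _ → singletons-independent _

L≅P₁ : L (singletons 0) ≅ P 1
L≅P₁ = flats≅P _ nbhd₁
  (from-yes (mono? nbhd₁)) (from-yes (cancel? nbhd₁)) (from-yes (onto? nbhd₁))
  (singletons-closed⇔ nbhd₁ (from-yes (allSubset? (isBlockMap? ∘ nbhd₁))))

L≅P₂ : L (singletons 1) ≅ P 2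
L≅P₂ = flats≅P _ nbhd₂
  (from-yes (mono? nbhd₂)) (from-yes (cancel? nbhd₂)) (from-yes (onto? nbhd₂))
  (singletons-closed⇔ nbhd₂ (from-yes (allSubset? (isBlockMap? ∘ nbhd₂))))

-- Coverings of three points

module _ (𝒞 : Covering 3) where

  Independent : Subset 3 → Set
  Independent = PartialTransversal 𝒞

  triple-dependent : ∀ {w} → HasCard (L 𝒞) (HasHeight (L 𝒞) 2) w → w < 3 → ¬ Independent ⊤
  triple-dependent card w<3 indep =
    contradiction (HasCard⇒≤ (L 𝒞) card pair height₂ pair-inj) (ℕ.<⇒≱ w<3)
    where
    flat : Subset 3 → Flat Independent
    flat X = record
      { elements = X
      ; closed   = closed-if-extensions-independent _ X λ _ _ → independent-⊆ 𝒞 ⊆⊤ indep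
      }

    pair : Fin 3 → Flat Independent
    -- The 2-subsets of three points are the complements of points, so `Fin 3` indexes them.
    pair i = flat (∁ ⁅ i ⁆)

    pair-inj : ∀ {i j : Fin 3} → ∁ ⁅ i ⁆ ≡ ∁ ⁅ j ⁆ → i ≡ j
    pair-inj {i} {j} = from-yes (Fin.all? {3} λ i → Fin.all? λ j →
      (∁ ⁅ i ⁆ ≟ˢ ∁ ⁅ j ⁆) →-dec (i Fin.≟ j)) i j

    size : ∀ i → ∣ ∁ {3} ⁅ i ⁆ ∣ ≡ 2
    size = from-yes (Fin.all? λ i → ∣ ∁ {3} ⁅ i ⁆ ∣ ℕ.≟ 2)

    chain₂ : ∀ i → ∃[ u ] (⊥ ⊆ ⁅ u ⁆ × ⊥ ≢ ⁅ u ⁆) × ⁅ u ⁆ ⊆ ∁ {3} ⁅ i ⁆ × ⁅ u ⁆ ≢ ∁ ⁅ i ⁆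
    chain₂ = from-yes (Fin.all? λ i → Fin.any? λ u →
      (⊥ ⊆? ⁅ u ⁆ ×-dec ¬? (⊥ ≟ˢ ⁅ u ⁆)) ×-dec
      (⁅ u ⁆ ⊆? ∁ {3} ⁅ i ⁆ ×-dec ¬? (⁅ u ⁆ ≟ˢ ∁ ⁅ i ⁆)))

    height₂ : ∀ i → HasHeight (L 𝒞) 2 (pair i)
    height₂ i with chain₂ i
    ... | u , ⊥≺u , u≺pair =
      step {y = pair i} (step {x = flat ⊥} {y = flat ⁅ u ⁆} start ⊥≺u) u≺pair ,
      λ ℓ c → subst (ℓ ≤_) (size i) (chain-length _ (pair i) c)

  module _ (pairs : ∀ u v → u ≢ v → Independent (⁅ u ⁆ ∪ ⁅ v ⁆))
           (dependent : ¬ Independent ⊤) where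

    small-independent : ∀ X → ∣ X ∣ ≤ 2 → Independent X
    small-independent X ∣X∣≤2 with in-pair X ∣X∣≤2
      where
      in-pair : ∀ X → ∣ X ∣ ≤ 2 → ∃[ u ] ∃[ v ] u ≢ v × X ⊆ ⁅ u ⁆ ∪ ⁅ v ⁆
      in-pair = from-yes (allSubset? {3} λ X → (∣ X ∣ ≤? 2) →-dec
        Fin.any? λ u → Fin.any? λ v → ¬? (u Fin.≟ v) ×-dec X ⊆? ⁅ u ⁆ ∪ ⁅ v ⁆)
    ... | u , v , u≢v , X⊆uv = independent-⊆ 𝒞 X⊆uv (pairs u v u≢v)

    independent⇒∣∣≤2 : ∀ I → Independent I → ∣ I ∣ ≤ 2
    independent⇒∣∣≤2 I indep with ℕ.m≤n⇒m<n∨m≡n (∣p∣≤n I)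
    ... | inj₁ (s≤s ∣I∣≤2) = ∣I∣≤2
    ... | inj₂ ∣I∣≡3       = contradiction (subst Independent (∣p∣≡n⇒p≡⊤ ∣I∣≡3) indep) dependent

    -- `X` is itself a largest independent subset of every set containing it, so adding a point
    -- leaves the rank at 2.
    2-subset-spans : ∀ X → ∣ X ∣ ≡ 2 → ∀ x → _∈cl_ Independent x X
    2-subset-spans X ∣X∣≡2 x = 2 , rank₂ id , rank₂ (p⊆p∪q _)
      where
      rank₂ : ∀ {Y} → X ⊆ Y → HasRank Independent Y 2
      rank₂ X⊆Y =
        (X , X⊆Y , small-independent X (ℕ.≤-reflexive ∣X∣≡2) , ∣X∣≡2) ,
        λ I _ → independent⇒∣∣≤2 I

    closed⇔∣∣≢2 : ∀ X → Closed Independent X ⇔ (∣ X ∣ ≢ 2)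
    closed⇔∣∣≢2 X = mk⇔ to from
      where
      to : Closed Independent X → ∣ X ∣ ≢ 2
      to closed ∣X∣≡2 = contradiction
        (p⊆q⇒∣p∣≤∣q∣ {p = ⊤} {X} (λ {x} _ → closed x (2-subset-spans X ∣X∣≡2 x)))
        (ℕ.<⇒≱ (s≤s (ℕ.≤-reflexive ∣X∣≡2)))

      -- Sets of size 0 or 1 have room for one more point, and the full set has no point outside.
      extension : ∀ X → ∣ X ∣ ≢ 2 → ∀ x → x ∉ X → ∣ X ∪ ⁅ x ⁆ ∣ ≤ 2
      extension = from-yes (allSubset? {3} λ X → ¬? (∣ X ∣ ℕ.≟ 2) →-dec
        Fin.all? λ x → ¬? (x ∈? X) →-dec (∣ X ∪ ⁅ x ⁆ ∣ ≤? 2))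

      from : ∣ X ∣ ≢ 2 → Closed Independent X
      from ∣X∣≢2 = closed-if-extensions-independent _ X λ x x∉X →
        small-independent _ (extension X ∣X∣≢2 x x∉X)

    L≅P₃ : L 𝒞 ≅ P 3
    L≅P₃ = flats≅P _ nbhd₃
      (from-yes (mono? nbhd₃)) (from-yes (cancel? nbhd₃)) (from-yes (onto? nbhd₃))
      λ X → mk⇔ (to X ∘ Equivalence.to (closed⇔∣∣≢2 X))
                (Equivalence.from (closed⇔∣∣≢2 X) ∘ from X)
      where
      -- Adjacency in a graph on three vertices fails to be transitive exactly when two of the three
      -- edges are present.
      to : ∀ X → ∣ X ∣ ≢ 2 → IsBlockMap (nbhd₃ X)
      to = from-yes (allSubset? λ X → ¬? (∣ X ∣ ℕ.≟ 2) →-dec isBlockMap? (nbhd₃ X))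

      from : ∀ X → IsBlockMap (nbhd₃ X) → ∣ X ∣ ≢ 2
      from = from-yes (allSubset? λ X → isBlockMap? (nbhd₃ X) →-dec ¬? (∣ X ∣ ℕ.≟ 2))

theorem4p12 : (∀ n → n ≡ 1 ⊎ n ≡ 2 → ∃[ m ] Σ[ 𝒞 ∈ Covering m ] L 𝒞 ≅ P n)
    ×
    (∀ (m : ℕ) (𝒞 : Covering m) →
    (∀ (u v : Fin m) → u ≢ v →
    ¬ (meeting 𝒞 ⁅ u ⁆ ∼[ set ] meeting 𝒞 ⁅ v ⁆ × length (meeting 𝒞 ⁅ u ⁆) ≡ 1)) →
    Uniform (L 𝒞) →
    (∃[ w ] HasCard (L 𝒞) (HasHeight (L 𝒞) 2) w × w < m C 2) →
    ∀ (k : ℕ) → k ≡ length (ℰ 𝒞) →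
    m ≡ 3 → k ≡ 1 → L 𝒞 ≅ P 3)
theorem4p12 =
  (λ { _ (inj₁ refl) → 0 , singletons 0 , L≅P₁
     ; _ (inj₂ refl) → 1 , singletons 1 , L≅P₂ }) ,
  -- Once `m` is 3, `m C 2` evaluates to 3, the number of pairs in `triple-dependent`.
  λ { _ 𝒞 distinct _ (_ , card , w<3) _ _ refl _ →
      L≅P₃ 𝒞 (λ u v u≢v → pair-independent 𝒞 (distinct u v u≢v))
             (triple-dependent 𝒞 card w<3) }
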